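{- Let $m,n,s,k,t$ be positive integers. If there is a simple $\mathrm{H}_t(m,n;s,k)$, then there exist a $(2ms+t,\,t,\,C_s,\,1)$-difference family and a $(2nk+t,\,t,\,C_k,\,1)$-difference family.
   Context: A partially filled (p.f.) $m\times n$ array is an $m\times n$ matrix in which some cells are allowed to be empty. Let $v=2nk+t$ with $t$ dividing $2nk$, and let $J$ be the subgroup of $\mathbb{Z}_v$ of order $t$. An $\mathrm{H}_t(m,n;s,k)$ (Heffter array over $\mathbb{Z}_v$ relative to $J$) is an $m\times n$ p.f. array with elements in $\mathbb{Z}_v$ such that: each row contains exactly $s$ filled cells and each column contains exactly $k$ filled cells (so $ms=nk$); for every $x\in\mathbb{Z}_v\setminus J$, either $x$ or $-x$ appears in the array; the elements in every row and every column sum to $0$ in $\mathbb{Z}_v$. An ordering $(t_1,\ldots,t_\ell)$ of a finite subset of an abelian group is simple if the partial sums $s_i=\sum_{j=1}^i t_j$, $i=1,\ldots,\ell$, are pairwise distinct. A p.f. array with entries in an abelian group is simple if for each row and each column there is a simple ordering of its elements. $C_\ell$ denotes the cycle of length $\ell$. For a graph $\Gamma$ with vertices in an additive group $G$, the list of differences is the multiset $\Delta\Gamma=\{\pm(x-y)\mid \{x,y\}\in E(\Gamma)\}$ (each edge contributes both $x-y$ and $y-x$); for a collection $\mathcal{F}$ of such graphs, $\Delta\mathcal{F}$ is the multiset union of the $\Delta\Gamma$, $\Gamma\in\mathcal{F}$. For $t$ dividing $v$, a $(v,t,\Gamma,\lambda)$-difference family is a collection $\mathcal{F}$ of graphs isomorphic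 to $\Gamma$ with vertices in $\mathbb{Z}_v$ such that each element of $\mathbb{Z}_v\setminus J$ appears exactly $\lambda$ times in $\Delta\mathcal{F}$ and no element of $J$ appears in it, where $J$ is the subgroup of $\mathbb{Z}_v$ of order $t$. -}

module Defs where

open import Algebra.Structures using (IsAbelianGroup)
open import Data.Fin using (Fin; toℕ)
open import Data.Fin.Properties using (toℕ<n; toℕ-injective; toℕ-fromℕ<) renaming (_≟_ to _≟F_)
open import Data.Fin.Subset using (Subset; ⊤; _∈_; _∉_; ∣_∣)
open import Data.Fin.Subset.Properties using (∈⊤)
open import Data.List using (List; length; take; foldr; map; filter; concatMap; cartesianProduct; allFin; catMaybes)
open import Data.List.Relation.Binary.Permutation.Propositional using (_↭_)
open import Data.List.Relation.Unary.All using (All)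
open import Data.Maybe using (Maybe; just)
open import Data.Nat as ℕ using (ℕ; suc; NonZero)
open import Data.Nat.DivMod using (_%_; _mod_; m%n<n; m<n⇒m%n≡m; %-distribˡ-+; n%n≡0)
open import Data.Nat.Divisibility using (_∣_)
import Data.Nat.Properties as ℕₚ
open import Data.Product using (Σ; ∃; ∃₂; _×_; _,_; proj₁)
open import Data.Sum using (_⊎_; swap)
open import Data.Vec.Functional using (Vector; toList; transpose)
open import Function using (_∘_)
open import Function.Bundles using (_↔_; _⇔_; module Inverse)
open import Function.Definitions using (Injective)
open import Level using (0ℓ)
open import Relation.Binary using (Rel; Decidable; Symmetric)
open import Relation.Binary.PropositionalEquality hiding (J)
open import Relation.Nullary using (¬_; ¬?; _×-dec_; _⊎-dec_)
import Data.List.Membership.Propositional as List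

+-nonZeroʳ : ∀ a t .{{_ : NonZero t}} → NonZero (a ℕ.+ t)
+-nonZeroʳ a (suc t) = subst NonZero (sym (ℕₚ.+-suc a t)) _

------------------------------------------------------------------------
-- The group ℤ_v, its elements being the residues 0, …, v - 1

ℤ/ : ℕ → Set
ℤ/ = Fin

module _ {v : ℕ} .{{_ : NonZero v}} where

  infixl 6 _+_ _-_
  infix  8 -_

  0# : ℤ/ v
  0# = 0 mod v

  _+_ : ℤ/ v → ℤ/ v → ℤ/ v
  x + y = (toℕ x ℕ.+ toℕ y) mod v

  -_ : ℤ/ v → ℤ/ v
  - x = (v ℕ.∸ toℕ x) mod v

  _-_ : ℤ/ v → ℤ/ v → ℤ/ v
  x - y = x + (- y)

  sum : List (ℤ/ v) → ℤ/ v
  sum = foldr _+_ 0#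

  private
    toℕ-mod : ∀ a → toℕ (a mod v) ≡ a % v
    toℕ-mod a = toℕ-fromℕ< (m%n<n a v)

    mod-cong : ∀ {a b} → a % v ≡ b % v → a mod v ≡ b mod v
    mod-cong {a} {b} p = toℕ-injective (trans (toℕ-mod a) (trans p (sym (toℕ-mod b))))

    mod-toℕ : (x : ℤ/ v) → toℕ x mod v ≡ x
    mod-toℕ x = toℕ-injective (trans (toℕ-mod (toℕ x)) (m<n⇒m%n≡m (toℕ<n x)))

    mod-+ : ∀ a b → a mod v + b mod v ≡ (a ℕ.+ b) mod v
    mod-+ a b = mod-cong (trans (cong₂ (λ c d → (c ℕ.+ d) % v) (toℕ-mod a) (toℕ-mod b))
                                (sym (%-distribˡ-+ a b v)))

    comm : ∀ x y → x + y ≡ y + x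
    comm x y = cong (_mod v) (ℕₚ.+-comm (toℕ x) (toℕ y))

    assoc : ∀ x y z → (x + y) + z ≡ x + (y + z)
    assoc x y z = begin
      (x + y) + z                              ≡⟨ cong ((x + y) +_) (mod-toℕ z) ⟨
      (x + y) + toℕ z mod v                    ≡⟨ mod-+ (toℕ x ℕ.+ toℕ y) (toℕ z) ⟩
      (toℕ x ℕ.+ toℕ y ℕ.+ toℕ z) mod v        ≡⟨ cong (_mod v) (ℕₚ.+-assoc (toℕ x) (toℕ y) (toℕ z)) ⟩
      (toℕ x ℕ.+ (toℕ y ℕ.+ toℕ z)) mod v      ≡⟨ mod-+ (toℕ x) (toℕ y ℕ.+ toℕ z) ⟨
      toℕ x mod v + (y + z)                    ≡⟨ cong (_+ (y + z)) (mod-toℕ x) ⟩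
      x + (y + z)                              ∎
      where open ≡-Reasoning

    identityˡ : ∀ x → 0# + x ≡ x
    identityˡ x = begin
      0# + x             ≡⟨ cong (0# +_) (mod-toℕ x) ⟨
      0# + toℕ x mod v   ≡⟨ mod-+ 0 (toℕ x) ⟩
      toℕ x mod v        ≡⟨ mod-toℕ x ⟩
      x                  ∎
      where open ≡-Reasoning

    inverseʳ : ∀ x → x - x ≡ 0#
    inverseʳ x = begin
      x - x                            ≡⟨ cong (_- x) (mod-toℕ x) ⟨
      toℕ x mod v - x                  ≡⟨ mod-+ (toℕ x) (v ℕ.∸ toℕ x) ⟩
      (toℕ x ℕ.+ (v ℕ.∸ toℕ x)) mod v  ≡⟨ cong (_mod v) (ℕₚ.m+[n∸m]≡n (ℕₚ.<⇒≤ (toℕ<n x))) ⟩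
      v mod v                          ≡⟨ mod-cong (trans (n%n≡0 v) (sym (m<n⇒m%n≡m (ℕ.>-nonZero⁻¹ v)))) ⟩
      0#                               ∎
      where open ≡-Reasoning

  +-0-isAbelianGroup : IsAbelianGroup _≡_ _+_ 0# (-_)
  +-0-isAbelianGroup = record
    { isGroup = record
      { isMonoid = record
        { isSemigroup = record
          { isMagma = isMagma _+_
          ; assoc   = assoc }
        ; identity = identityˡ , λ x → trans (comm x 0#) (identityˡ x) }
      ; inverse = (λ x → trans (comm (- x) x) (inverseʳ x)) , inverseʳ
      ; ⁻¹-cong = cong (-_) }
    ; comm = comm }
    where open import Relation.Binary.PropositionalEquality.Algebra using (isMagma)

-- For t ∣ v the group ℤ_v has exactly one subgroup of order t, so "the subgroup J
-- of order t" is rendered as a subset J together with a proof of this property.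
record IsSubgroupOfOrder {v : ℕ} .{{_ : NonZero v}} (t : ℕ) (J : Subset v) : Set where
  field
    0∈J      : 0# ∈ J
    +-closed : ∀ {x y} → x ∈ J → y ∈ J → x + y ∈ J
    -‿closed : ∀ {x} → x ∈ J → - x ∈ J
    order    : ∣ J ∣ ≡ t

------------------------------------------------------------------------
-- Partially filled arrays and relative Heffter arrays

-- nothing marks an empty cell.
PFArray : Set → ℕ → ℕ → Set
PFArray X m n = Vector (Vector (Maybe X) n) m

module _ {X : Set} {m n : ℕ} (A : PFArray X m n) where

  row : Fin m → List X
  row i = catMaybes (toList (A i))

  column : Fin n → List X
  column j = catMaybes (toList (transpose A j))

  Appears : X → Set
  Appears x = ∃₂ λ i j → A i j ≡ just x

record IsHeffterArray (m n s k t : ℕ) .{{_ : NonZero (2 ℕ.* n ℕ.* k ℕ.+ t)}}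
                      (A : PFArray (ℤ/ (2 ℕ.* n ℕ.* k ℕ.+ t)) m n) : Set where
  field
    t∣2nk       : t ∣ 2 ℕ.* n ℕ.* k
    J           : Subset (2 ℕ.* n ℕ.* k ℕ.+ t)
    J-subgroup  : IsSubgroupOfOrder t J
    row-size    : ∀ i → length (row A i) ≡ s
    column-size : ∀ j → length (column A j) ≡ k
    covers      : ∀ x → x ∉ J → Appears A x ⊎ Appears A (- x)
    row-sum     : ∀ i → sum (row A i) ≡ 0#
    column-sum  : ∀ j → sum (column A j) ≡ 0#

module _ {v : ℕ} .{{_ : NonZero v}} where

  -- The index i : Fin ℓ stands for i + 1, so the partial sums range over the
  -- nonempty prefixes.
  partialSum : (ω : List (ℤ/ v)) → Fin (length ω) → ℤ/ v
  partialSum ω i = sum (take (suc (toℕ i)) ω)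

  SimpleOrdering : List (ℤ/ v) → Set
  SimpleOrdering ω = Injective _≡_ _≡_ (partialSum ω)

  -- A row or column is listed with repetitions; in a relative Heffter array a
  -- count of the filled cells shows that the entries are distinct anyway.
  SimpleArray : ∀ {m n} → PFArray (ℤ/ v) m n → Set
  SimpleArray A = (∀ i → ∃ λ ω → ω ↭ row A i × SimpleOrdering ω)
                × (∀ j → ∃ λ ω → ω ↭ column A j × SimpleOrdering ω)

------------------------------------------------------------------------
-- Graphs and difference families

-- Finite simple graphs whose vertices are some (not necessarily all) of the
-- elements of Fin N.
record Graph (N : ℕ) : Set₁ where
  infix 4 _~_ _~?_
  field
    vertices : Subset N
    _~_      : Rel (Fin N) 0ℓ
    _~?_     : Decidable _~_
    ~-sym    : Symmetric _~_
    ~-irrefl : ∀ {x} → ¬ (x ~ x)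
    ~-vertex : ∀ {x y} → x ~ y → x ∈ vertices

  Vertex : Set
  Vertex = Σ (Fin N) (_∈ vertices)

infix 4 _≅_

_≅_ : ∀ {M N} → Graph M → Graph N → Set
Γ ≅ Γ′ = Σ (G.Vertex ↔ G′.Vertex) λ f →
           ∀ x y → (proj₁ x G.~ proj₁ y) ⇔ (proj₁ (Inverse.to f x) G′.~ proj₁ (Inverse.to f y))
  where
  module G  = Graph Γ
  module G′ = Graph Γ′

-- The cycle 0 ~ 1 ~ ⋯ ~ ℓ - 1 ~ 0 for ℓ ≥ 3; for ℓ = 1, 2 it degenerates to K₁
-- and K₂. The condition i ≢ j only matters for ℓ = 1, where it excludes a loop.
C : (ℓ : ℕ) .{{_ : NonZero ℓ}} → Graph ℓ
C ℓ = record
  { vertices = ⊤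
  ; _~_      = λ i j → i ≢ j × (Next i j ⊎ Next j i)
  ; _~?_     = λ i j → ¬? (i ≟F j) ×-dec (next? i j ⊎-dec next? j i)
  ; ~-sym    = λ (i≢j , e) → i≢j ∘ sym , swap e
  ; ~-irrefl = λ (i≢i , _) → i≢i refl
  ; ~-vertex = λ _ → ∈⊤
  }
  where
  Next : Rel (Fin ℓ) 0ℓ
  Next i j = toℕ j ≡ suc (toℕ i) % ℓ

  next? : Decidable Next
  next? i j = toℕ j ℕ.≟ suc (toℕ i) % ℓ

module _ {v : ℕ} .{{_ : NonZero v}} where

  -- Each edge {x , y} occurs as the two ordered pairs (x , y) and (y , x),
  -- hence contributes both x - y and y - x.
  Δ : Graph v → List (ℤ/ v)
  Δ Γ = map (λ (x , y) → x - y)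
            (filter (λ (x , y) → x ~? y) (cartesianProduct (allFin v) (allFin v)))
    where open Graph Γ

  Δs : List (Graph v) → List (ℤ/ v)
  Δs = concatMap Δ

  multiplicity : ℤ/ v → List (ℤ/ v) → ℕ
  multiplicity x xs = length (filter (x ≟F_) xs)

record IsDifferenceFamily (v t : ℕ) .{{_ : NonZero v}} {N : ℕ} (Γ : Graph N) (μ : ℕ)
                          (F : List (Graph v)) : Set₁ where
  field
    t∣v        : t ∣ v
    J          : Subset v
    J-subgroup : IsSubgroupOfOrder t J
    blocks     : All (_≅ Γ) F
    outside-J  : ∀ x → x ∉ J → multiplicity x (Δs F) ≡ μ
    inside-J   : ∀ x → x ∈ J → x List.∉ Δs F

{-# OPTIONS --safe #-}

-- A simple ordering ω of a row (or column) with zero sum turns into a cycle whose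
-- vertices are the partial sums of ω; consecutive partial sums differ by an entry of
-- ω, so the differences of the cycle are the entries of ω and their opposites.
-- The array has nk = ms entries, whose 2nk signed versions cover the 2nk elements
-- outside J. Hence every element outside J is hit exactly once and none of J is.
-- In particular 0 is no entry and no two entries are opposite, which excludes the
-- degenerate cycles of length 1 and 2.
module Submission where

open import Defs using (+-nonZeroʳ; IsHeffterArray; SimpleArray; C; IsDifferenceFamily)
open import Data.Nat using (ℕ; NonZero; _+_; _*_)
open import Data.Product using (∃; _×_)

open import Defs using (ℤ/; 0#; sum; +-0-isAbelianGroup; IsSubgroupOfOrder; PFArray; row; column;
  partialSum; SimpleOrdering; Graph; _≅_; Δ; Δs; multiplicity; Appears)
open import Algebra.Bundles using (AbelianGroup; CommutativeMonoid)
import Algebra.Properties.AbelianGroup as AbelianGroupProperties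
open import Data.Fin using (Fin; zero; suc; toℕ; fromℕ; inject₁)
open import Data.Fin.Properties using (toℕ-fromℕ; toℕ-inject₁; toℕ<n; any?)
  renaming (_≟_ to _≟F_)
open import Data.Fin.Subset using (Subset; inside; outside; ∣_∣; ∁)
  renaming (_∈_ to _∈ₛ_)
open import Data.Fin.Subset.Properties using (_∈?_; ∈⊤; ∣∁p∣≡n∸∣p∣; x∈p⇒x∉∁p; x∉p⇒x∈∁p; x∈∁p⇒x∉p)
open import Data.List using (List; []; _∷_; [_]; _++_; length; map; take; lookup; filter; concatMap;
  allFin; tabulate; catMaybes; cartesianProduct; fromMaybe)
open import Data.List.Membership.Propositional using (_∈_; _∉_)
open import Data.List.Membership.Propositional.Properties using (∈-∃++; ∈-map⁺;
  ∈-filter⁺; ∈-filter⁻; ∈-allFin; ∈-cartesianProduct⁺; ∈-concatMap⁺; ∈-concatMap⁻)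
open import Data.List.Membership.Propositional.Properties.WithK using (unique∧set⇒bag)
import Data.List.Membership.DecPropositional as DecMembership
open import Data.List.Properties using (length-++; map-tabulate; tabulate-lookup; concatMap-cong; concatMap-map;
  map-concatMap; concatMap-++; take-suc; take-all; length-tabulate)
open import Data.List.Relation.Binary.BagAndSetEquality using (∼bag⇒↭)
open import Data.List.Relation.Binary.Permutation.Propositional using (_↭_; refl; prep; swap; trans;
  ↭-refl; ↭-sym; ↭-trans; ↭-reflexive; ↭⇒↭ₛ; module PermutationReasoning)
open import Data.List.Relation.Binary.Permutation.Propositional.Properties using (++⁺; ++⁺ˡ; ↭-length; shift; shifts;
  filter-↭; ∈-resp-↭; ++-commutativeMonoid) renaming (map⁺ to ↭-map⁺)
import Data.List.Relation.Binary.Permutation.Setoid.Properties as PermutationSetoid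
open import Data.List.Relation.Binary.Subset.Propositional using (_⊆_)
open import Data.List.Relation.Unary.All as All using ([]; _∷_)
import Data.List.Relation.Unary.All.Properties as Allₚ
open import Data.List.Relation.Unary.AllPairs using ([]; _∷_)
open import Data.List.Relation.Unary.Any as Any using (here; there)
open import Data.List.Relation.Unary.Unique.Propositional using (Unique)
open import Data.List.Relation.Unary.Unique.Propositional.Properties using (allFin⁺; cartesianProduct⁺)
  renaming (map⁻ to Unique-map⁻; filter⁺ to Unique-filter⁺)
open import Data.Maybe using (Maybe; just; nothing)
open import Data.Nat using (_≤_; _∸_) renaming (suc to 1+_)
open import Data.Nat.Divisibility using (_∣_; ∣m∣n⇒∣m+n; ∣-refl)
open import Data.Nat.DivMod using (_%_; n%n≡0; m<n⇒m%n≡m)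
open import Data.Nat.Properties using (≤-pred; ≤-reflexive; m≤n⇒m<n∨m≡n; m+n∸n≡m; *-comm; *-assoc)
open import Data.Product using (_,_; proj₁; proj₂)
open import Data.Product.Properties using (≡-dec)
open import Data.Sum using (_⊎_; inj₁; inj₂)
import Data.Vec as Vec
open import Data.Vec.Properties using (lookup∘tabulate; []=⇒lookup; lookup⇒[]=)
open import Data.Vec.Properties.WithK using ([]=-irrelevant)
open import Function using (_∘_; id; flip)
open import Function.Bundles using (_⇔_; mk⇔; mk↔ₛ′)
open import Level using (Level; 0ℓ)
open import Relation.Binary.PropositionalEquality using (_≡_; refl; sym; cong; cong₂; subst; subst₂; setoid;
  module ≡-Reasoning) renaming (trans to ≡-trans)
open import Relation.Nullary using (does; yes; no; contradiction)
open import Relation.Nullary.Decidable using (dec-true)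
open import Relation.Unary using (Pred; Decidable)

private variable
  a b p : Level
  A : Set a
  B : Set b

-- Lists and permutations

concatMap⁺-↭ : (f : A → List B) {xs ys : List A} → xs ↭ ys → concatMap f xs ↭ concatMap f ys
concatMap⁺-↭ f refl         = ↭-refl
concatMap⁺-↭ f (prep x p)   = ++⁺ˡ (f x) (concatMap⁺-↭ f p)
concatMap⁺-↭ f (swap x y p) = ↭-trans (shifts (f x) (f y)) (++⁺ˡ (f y) (++⁺ˡ (f x) (concatMap⁺-↭ f p)))
concatMap⁺-↭ f (trans p q)  = ↭-trans (concatMap⁺-↭ f p) (concatMap⁺-↭ f q)

concatMap-cong-↭ : {f g : A → List B} → (∀ x → f x ↭ g x) → ∀ xs → concatMap f xs ↭ concatMap g xs
concatMap-cong-↭ f↭g []       = ↭-refl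
concatMap-cong-↭ f↭g (x ∷ xs) = ++⁺ (f↭g x) (concatMap-cong-↭ f↭g xs)

concatMap-++-↭ : (f g : A → List B) → ∀ xs →
                 concatMap (λ x → f x ++ g x) xs ↭ concatMap f xs ++ concatMap g xs
concatMap-++-↭ f g []       = ↭-refl
concatMap-++-↭ {B = B} f g (x ∷ xs) =
  ↭-trans (++⁺ˡ (f x ++ g x) (concatMap-++-↭ f g xs))
          (interchange (f x) (g x) (concatMap f xs) (concatMap g xs))
  where open import Algebra.Properties.CommutativeSemigroup
               (CommutativeMonoid.commutativeSemigroup (++-commutativeMonoid {A = B})) using (interchange)

concatMap-const-[] : (xs : List A) → concatMap {B = B} (λ _ → []) xs ≡ []
concatMap-const-[] []       = refl
concatMap-const-[] (_ ∷ xs) = concatMap-const-[] xs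

-- Exchange of two nested loops by induction on the outer list. Applied to the cells of an array, it
-- compares the listing by rows with the listing by columns.
concatMap-comm : ∀ {c} {D : Set c} (f : A → B → List D) → ∀ xs ys →
                 concatMap (λ x → concatMap (f x) ys) xs ↭ concatMap (λ y → concatMap (flip f y) xs) ys
concatMap-comm f []       ys = ↭-reflexive (sym (concatMap-const-[] ys))
concatMap-comm f (x ∷ xs) ys =
  ↭-trans (++⁺ˡ (concatMap (f x) ys) (concatMap-comm f xs ys))
          (↭-sym (concatMap-++-↭ (f x) (λ y → concatMap (flip f y) xs) ys))

concatMap-concatMap : ∀ {c} {D : Set c} (g : B → List D) (f : A → List B) → ∀ xs →
                      concatMap g (concatMap f xs) ≡ concatMap (concatMap g ∘ f) xs
concatMap-concatMap g f []       = refl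
concatMap-concatMap g f (x ∷ xs) = ≡-trans (concatMap-++ g (f x) (concatMap f xs))
                                           (cong (concatMap g (f x) ++_) (concatMap-concatMap g f xs))

length-concatMap : ∀ {ℓ} (f : A → List B) → (∀ x → length (f x) ≡ ℓ) →
                   ∀ xs → length (concatMap f xs) ≡ length xs * ℓ
length-concatMap f eq []       = refl
length-concatMap f eq (x ∷ xs) = ≡-trans (length-++ (f x)) (cong₂ _+_ (eq x) (length-concatMap f eq xs))

-- An empty cell contributes the empty list. In this form a row or column is a loop over its
-- indices, ready for the exchange of loops.
catMaybes-map : (f : A → Maybe B) → ∀ xs → catMaybes (map f xs) ≡ concatMap (fromMaybe ∘ f) xs
catMaybes-map f []       = refl
catMaybes-map f (x ∷ xs) with f x
... | just y  = cong (y ∷_) (catMaybes-map f xs)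
... | nothing = catMaybes-map f xs

Unique-++⁻ˡ : (xs : List A) {ys : List A} → Unique (xs ++ ys) → Unique xs
Unique-++⁻ˡ []       _        = []
Unique-++⁻ˡ (x ∷ xs) (px ∷ p) = Allₚ.++⁻ˡ xs px ∷ Unique-++⁻ˡ xs p

Unique-++⁻ʳ : (xs : List A) {ys : List A} → Unique (xs ++ ys) → Unique ys
Unique-++⁻ʳ []       p       = p
Unique-++⁻ʳ (x ∷ xs) (_ ∷ p) = Unique-++⁻ʳ xs p

Unique-concatMap⁻ : (f : A → List B) {xs : List A} → Unique (concatMap f xs) → ∀ {x} → x ∈ xs → Unique (f x)
Unique-concatMap⁻ f u (here refl)           = Unique-++⁻ˡ (f _) u
Unique-concatMap⁻ f {x ∷ _} u (there x∈xs) = Unique-concatMap⁻ f (Unique-++⁻ʳ (f x) u) x∈xs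

Unique-resp-↭ : {xs ys : List A} → xs ↭ ys → Unique xs → Unique ys
Unique-resp-↭ {A = A} p = PermutationSetoid.Unique-resp-↭ (setoid A) (↭⇒↭ₛ p)

-- Without repetitions every multiplicity is 0 or 1, so membership alone determines a list up to
-- permutation.
unique∧set⇒↭ : {xs ys : List A} → Unique xs → Unique ys → (∀ {x} → x ∈ xs ⇔ x ∈ ys) → xs ↭ ys
unique∧set⇒↭ ux uy eq = ∼bag⇒↭ (unique∧set⇒bag ux uy eq)

-- Pigeonhole: a duplicate-free list contained in one that is not longer exhausts it.
unique∧⊆∧length⇒↭ : {xs ys : List A} → Unique xs → xs ⊆ ys → length ys ≤ length xs → xs ↭ ys
unique∧⊆∧length⇒↭ {ys = []}    []         _  _  = ↭-refl
unique∧⊆∧length⇒↭ {xs = x ∷ xs} (x∉xs ∷ u) xs⊆ys le with ∈-∃++ (xs⊆ys (here refl))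
... | as , bs , refl = ↭-trans (prep x (unique∧⊆∧length⇒↭ u rest le′)) (↭-sym (shift x as bs))
  where
  le′ : length (as ++ bs) ≤ length xs
  le′ = ≤-pred (subst (_≤ _) (↭-length (shift x as bs)) le)
  rest : xs ⊆ as ++ bs
  rest z∈xs with ∈-resp-↭ (shift x as bs) (xs⊆ys (there z∈xs))
  ... | here refl = contradiction refl (All.lookup x∉xs z∈xs)
  ... | there z∈  = z∈

-- The function `f` is general for the sake of the induction, which replaces it by `f ∘ suc`; the
-- application has `f = id`.
length-filter-tabulate : ∀ {n} {P : Pred A p} (P? : Decidable P) (f : Fin n → A) (q : Subset n) →
                         (∀ i → does (P? (f i)) ≡ Vec.lookup q i) → length (filter P? (tabulate f)) ≡ ∣ q ∣
length-filter-tabulate P? f Vec.[]              eq = refl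
length-filter-tabulate P? f (inside  Vec.∷ q) eq rewrite eq zero =
  cong 1+_ (length-filter-tabulate P? (f ∘ suc) q (eq ∘ suc))
length-filter-tabulate P? f (outside Vec.∷ q) eq rewrite eq zero =
  length-filter-tabulate P? (f ∘ suc) q (eq ∘ suc)

-- Subsets of Fin n

elements : ∀ {n} → Subset n → List (Fin n)
elements q = filter (_∈? q) (allFin _)

does-∈? : ∀ {n} (i : Fin n) (q : Subset n) → does (i ∈? q) ≡ Vec.lookup q i
does-∈? zero    (inside  Vec.∷ q) = refl
does-∈? zero    (outside Vec.∷ q) = refl
does-∈? (suc i) (_       Vec.∷ q) = does-∈? i q

length-elements : ∀ {n} (q : Subset n) → length (elements q) ≡ ∣ q ∣
length-elements q = length-filter-tabulate (_∈? q) id q (λ i → does-∈? i q)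

elements-unique : ∀ {n} (q : Subset n) → Unique (elements q)
elements-unique q = Unique-filter⁺ (_∈? q) (allFin⁺ _)

∈-elements⁺ : ∀ {n x} {q : Subset n} → x ∈ₛ q → x ∈ elements q
∈-elements⁺ {q = q} = ∈-filter⁺ (_∈? q) (∈-allFin _)

∈-elements⁻ : ∀ {n x} {q : Subset n} → x ∈ elements q → x ∈ₛ q
∈-elements⁻ {q = q} = proj₂ ∘ ∈-filter⁻ (_∈? q) {xs = allFin _}

image : ∀ {ℓ n} → (Fin ℓ → Fin n) → Subset n
image f = Vec.tabulate λ x → does (any? λ i → f i ≟F x)

∈-image⁺ : ∀ {ℓ n} (f : Fin ℓ → Fin n) i → f i ∈ₛ image f
∈-image⁺ f i = lookup⇒[]= (f i) _
  (≡-trans (lookup∘tabulate _ (f i)) (dec-true (any? _) (i , refl)))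

∈-image⁻ : ∀ {ℓ n} (f : Fin ℓ → Fin n) {x} → x ∈ₛ image f → ∃ λ i → f i ≡ x
∈-image⁻ f {x} x∈ with any? (λ i → f i ≟F x) | ≡-trans (sym (lookup∘tabulate _ x)) ([]=⇒lookup x∈)
... | yes w | _ = w
... | no _  | ()

-- Cyclic successors, as in the definition of C

prev : ∀ {n} .{{_ : NonZero n}} (i : Fin n) → ∃ λ (j : Fin n) → toℕ i ≡ 1+ (toℕ j) % n
-- Index 0 is preceded by the last index, whose successor wraps around.
prev {1+ n} zero    = fromℕ n , sym (≡-trans (cong (λ k → 1+ k % 1+ n) (toℕ-fromℕ n)) (n%n≡0 (1+ n)))
prev {1+ n} (suc i) = inject₁ i , sym (≡-trans (cong (λ k → 1+ k % 1+ n) (toℕ-inject₁ i))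
                                              (m<n⇒m%n≡m (toℕ<n (suc i))))

-- Sums, signed lists and multiplicities in ℤ_v.

module _ {v : ℕ} .{{_ : NonZero v}} where

  open Defs using (_-_; -_) renaming (_+_ to _⊕_)

  ℤ/-abelianGroup : AbelianGroup 0ℓ 0ℓ
  ℤ/-abelianGroup = record { isAbelianGroup = +-0-isAbelianGroup {v} }

  open AbelianGroup ℤ/-abelianGroup using (assoc; inverseʳ; comm; isCommutativeMonoid)
  open AbelianGroupProperties ℤ/-abelianGroup using (xyx⁻¹≈y; ⁻¹-anti-homo‿-; ⁻¹-involutive)

  sum-∷ʳ : ∀ xs (x : ℤ/ v) → sum (xs ++ [ x ]) ≡ sum xs ⊕ x
  sum-∷ʳ []       x = comm x 0#
  sum-∷ʳ (y ∷ xs) x = ≡-trans (cong (y ⊕_) (sum-∷ʳ xs x)) (sym (assoc y (sum xs) x))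

  sum-↭ : {xs ys : List (ℤ/ v)} → xs ↭ ys → sum xs ≡ sum ys
  sum-↭ p = PermutationSetoid.foldr-commMonoid (setoid (ℤ/ v)) isCommutativeMonoid (↭⇒↭ₛ p)

  infix 8 ±_

  ±_ : List (ℤ/ v) → List (ℤ/ v)
  ±_ = concatMap λ x → x ∷ - x ∷ []

  length-± : ∀ xs → length (± xs) ≡ 2 * length xs
  length-± xs = ≡-trans (length-concatMap _ (λ _ → refl) xs) (*-comm (length xs) 2)

  ∈-±⁺ : ∀ {x xs} → x ∈ xs ⊎ - x ∈ xs → x ∈ ± xs
  ∈-±⁺ (inj₁ x∈) = ∈-concatMap⁺ _ (Any.map here x∈)
  -- The second signed version of the entry `- x` is `- (- x)`, that is `x`.
  ∈-±⁺ {x} (inj₂ -x∈) = ∈-concatMap⁺ _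
    (Any.map (λ { refl → there (here (sym (⁻¹-involutive x))) }) -x∈)

  multiplicity-↭ : ∀ x {xs ys} → xs ↭ ys → multiplicity x xs ≡ multiplicity x ys
  multiplicity-↭ x p = ↭-length (filter-↭ (x ≟F_) p)

  multiplicity-unique : ∀ {x xs} → Unique xs → x ∈ xs → multiplicity x xs ≡ 1
  multiplicity-unique {x} {xs} u x∈xs = ↭-length (unique∧set⇒↭ (Unique-filter⁺ (x ≟F_) u) ([] ∷ [])
    (mk⇔ (λ z∈ → here (sym (proj₂ (∈-filter⁻ (x ≟F_) {xs = xs} z∈))))
         (λ { (here refl) → ∈-filter⁺ (x ≟F_) x∈xs refl })))

  -- The cycle of partial sums of a simple ordering with zero sum.

  module Cycle (ω : List (ℤ/ v)) .{{_ : NonZero (length ω)}} (sum≡0 : sum ω ≡ 0#)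
               (simple : SimpleOrdering ω) (unique : Unique (± ω)) (0∉± : 0# ∉ ± ω) where

    -- The entry at `i` will be the step from `before i` to `after i`. The values of `after`,
    -- distinct by simplicity, will be the vertices.
    before after : Fin (length ω) → ℤ/ v
    before i = sum (take (toℕ i) ω)
    after    = partialSum ω

    after≡before⊕entry : ∀ i → after i ≡ before i ⊕ lookup ω i
    after≡before⊕entry i = ≡-trans (cong sum (take-suc ω i)) (sum-∷ʳ (take (toℕ i) ω) (lookup ω i))

    after-before : ∀ i → after i - before i ≡ lookup ω i
    after-before i = ≡-trans (cong (_- before i) (after≡before⊕entry i)) (xyx⁻¹≈y (before i) (lookup ω i))

    before-after : ∀ i → before i - after i ≡ - lookup ω i
    before-after i = ≡-trans (sym (⁻¹-anti-homo‿- (after i) (before i))) (cong -_ (after-before i))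

    -- Short of the last index, both sides are sums of the same prefix. At the last index `before j`
    -- is the empty sum and `after i` the full one; they agree because `ω` sums to zero, and this
    -- closes the cycle.
    before-next : ∀ i j → toℕ j ≡ 1+ (toℕ i) % length ω → before j ≡ after i
    before-next i j eq with m≤n⇒m<n∨m≡n (toℕ<n i)
    ... | inj₁ lt = cong (λ k → sum (take k ω)) (≡-trans eq (m<n⇒m%n≡m lt))
    ... | inj₂ end = begin
      before j                  ≡⟨ cong (λ k → sum (take k ω)) j≡0 ⟩
      0#                        ≡⟨ sum≡0 ⟨
      sum ω                     ≡⟨ cong sum (take-all (1+ (toℕ i)) ω (≤-reflexive (sym end))) ⟨
      after i                   ∎
      where
      open ≡-Reasoning
      j≡0 : toℕ j ≡ 0
      j≡0 = ≡-trans eq (≡-trans (cong (_% length ω) end) (n%n≡0 (length ω)))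

    -- Both orientations of each edge are listed, matching the ordered pairs counted by `Δ`.
    edges : List (ℤ/ v × ℤ/ v)
    edges = concatMap (λ i → (after i , before i) ∷ (before i , after i) ∷ []) (allFin (length ω))

    ∈-edges⁺ : ∀ {x y} → (∃ λ i → (x , y) ≡ (after i , before i) ⊎ (x , y) ≡ (before i , after i)) →
               (x , y) ∈ edges
    ∈-edges⁺ (i , e) = ∈-concatMap⁺ _ (Any.map (λ { refl → pair e }) (∈-allFin i))
      where
      pair : ∀ {z} → z ≡ (after i , before i) ⊎ z ≡ (before i , after i) →
             z ∈ (after i , before i) ∷ (before i , after i) ∷ []
      pair (inj₁ eq) = here eq
      pair (inj₂ eq) = there (here eq)

    ∈-edges⁻ : ∀ {x y} → (x , y) ∈ edges →
               ∃ λ i → (x , y) ≡ (after i , before i) ⊎ (x , y) ≡ (before i , after i)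
    ∈-edges⁻ e with Any.satisfied (∈-concatMap⁻ _ {xs = allFin (length ω)} e)
    ... | i , here eq         = i , inj₁ eq
    ... | i , there (here eq) = i , inj₂ eq

    -- This is an equality of lists, not only a permutation: at each index the pair with difference
    -- `lookup ω i` precedes the reversed pair, the order used in `±_`.
    differences : map (λ (x , y) → x - y) edges ≡ ± ω
    differences = begin
      map (λ (x , y) → x - y) edges
        ≡⟨ map-concatMap (λ (x , y) → x - y) _ (allFin (length ω)) ⟩
      concatMap (λ i → (after i - before i) ∷ (before i - after i) ∷ []) (allFin (length ω))
        ≡⟨ concatMap-cong (λ i → cong₂ (λ x y → x ∷ y ∷ []) (after-before i) (before-after i)) (allFin (length ω)) ⟩
      concatMap (λ i → lookup ω i ∷ - lookup ω i ∷ []) (allFin (length ω))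
        ≡⟨ concatMap-map _ (lookup ω) (allFin (length ω)) ⟨
      ± map (lookup ω) (allFin (length ω))
        ≡⟨ cong ±_ (≡-trans (map-tabulate id (lookup ω)) (tabulate-lookup ω)) ⟩
      ± ω
        ∎
      where open ≡-Reasoning

    -- A loop would contribute the difference 0, which `0∉±` excludes.
    edges-irrefl : ∀ {x} → (x , x) ∉ edges
    edges-irrefl {x} e = 0∉± (subst₂ _∈_ (inverseʳ x) differences (∈-map⁺ (λ (x , y) → x - y) e))

    edges-sym : ∀ {x y} → (x , y) ∈ edges → (y , x) ∈ edges
    edges-sym e with ∈-edges⁻ e
    ... | i , inj₁ refl = ∈-edges⁺ (i , inj₂ refl)
    ... | i , inj₂ refl = ∈-edges⁺ (i , inj₁ refl)

    edges-vertex : ∀ {x y} → (x , y) ∈ edges → x ∈ₛ image after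
    edges-vertex e with ∈-edges⁻ e
    ... | i , inj₁ refl = ∈-image⁺ after i
    -- The vertex set is the image of `after`; `before i` belongs to it as the value of `after` at
    -- the cyclic predecessor of `i`.
    ... | i , inj₂ refl with j , eq ← prev i = subst (_∈ₛ image after) (sym (before-next j i eq)) (∈-image⁺ after j)

    cycle : Graph v
    cycle = record
      { vertices = image after
      ; _~_      = λ x y → (x , y) ∈ edges
      ; _~?_     = λ x y → DecMembership._∈?_ (≡-dec _≟F_ _≟F_) (x , y) edges
      ; ~-sym    = edges-sym
      ; ~-irrefl = edges-irrefl
      ; ~-vertex = edges-vertex
      }

    -- The pairs in `edges` are distinct because already their differences, the list `± ω`, are. So
    -- `edges` and the filtered list of all pairs are repetition-free with the same members.
    cycle-Δ : Δ cycle ↭ ± ω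
    cycle-Δ = ↭-trans (↭-map⁺ (λ (x , y) → x - y) (unique∧set⇒↭
                        (Unique-filter⁺ (λ (x , y) → x ~? y) (cartesianProduct⁺ (allFin⁺ v) (allFin⁺ v)))
                        (Unique-map⁻ (subst Unique (sym differences) unique))
                        (mk⇔ (λ e → proj₂ (∈-filter⁻ (λ (x , y) → x ~? y) {xs = cartesianProduct (allFin v) (allFin v)} e))
                             (λ e → ∈-filter⁺ (λ (x , y) → x ~? y)
                                              (∈-cartesianProduct⁺ (∈-allFin _) (∈-allFin _)) e))))
                      (↭-reflexive differences)
      where open Graph cycle using (_~?_)

    open Graph (C (length ω)) using () renaming (_~_ to _~C_)

    edges⇒~C : ∀ i j → (after i , after j) ∈ edges → i ~C j
    edges⇒~C i j e = (λ { refl → edges-irrefl e }) , adjacent (∈-edges⁻ e)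
      where
      -- `before i` is also `after` at the cyclic predecessor of `i`, so simplicity identifies `j`
      -- with that predecessor.
      previous : ∀ i j → after j ≡ before i → toℕ i ≡ 1+ (toℕ j) % length ω
      previous i j eq = subst (λ k → toℕ i ≡ 1+ (toℕ k) % length ω)
        (simple (≡-trans (sym (before-next _ i (proj₂ (prev i)))) (sym eq))) (proj₂ (prev i))

      adjacent : (∃ λ h → (after i , after j) ≡ (after h , before h) ⊎ (after i , after j) ≡ (before h , after h)) →
                 toℕ j ≡ 1+ (toℕ i) % length ω ⊎ toℕ i ≡ 1+ (toℕ j) % length ω
      adjacent (h , inj₁ eq) with refl ← simple {i} {h} (cong proj₁ eq) = inj₂ (previous i j (cong proj₂ eq))
      adjacent (h , inj₂ eq) with refl ← simple {j} {h} (cong proj₂ eq) = inj₁ (previous j i (cong proj₁ eq))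

    ~C⇒edges : ∀ i j → i ~C j → (after i , after j) ∈ edges
    -- If `j` follows `i`, then `after i` is `before j`, so the pair is the edge of the entry at
    -- `j`.
    ~C⇒edges i j (_ , inj₁ next) = ∈-edges⁺ (j , inj₂ (cong (_, after j) (sym (before-next i j next))))
    ~C⇒edges i j (_ , inj₂ next) = ∈-edges⁺ (i , inj₁ (cong (after i ,_) (sym (before-next j i next))))

    cycle-≅ : cycle ≅ C (length ω)
    cycle-≅ = mk↔ₛ′ to from to∘from from∘to , edge
      where
      to : Graph.Vertex cycle → Graph.Vertex (C (length ω))
      to (_ , x∈) = proj₁ (∈-image⁻ after x∈) , ∈⊤

      from : Graph.Vertex (C (length ω)) → Graph.Vertex cycle
      from (i , _) = after i , ∈-image⁺ after i

      vertex-≡ : ∀ {n} {q : Subset n} {x y} {x∈ : x ∈ₛ q} {y∈ : y ∈ₛ q} → x ≡ y → (x , x∈) ≡ (y , y∈)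
      vertex-≡ refl = cong (_ ,_) ([]=-irrelevant _ _)

      to∘from : ∀ y → to (from y) ≡ y
      -- The search behind `∈-image⁻` returns some index with partial sum `after i`; simplicity
      -- makes it `i`.
      to∘from (i , _) = vertex-≡ (simple (proj₂ (∈-image⁻ after (∈-image⁺ after i))))

      from∘to : ∀ x → from (to x) ≡ x
      from∘to (_ , x∈) = vertex-≡ (proj₂ (∈-image⁻ after x∈))

      edge : ∀ x y → (proj₁ x , proj₁ y) ∈ edges ⇔ (proj₁ (to x) ~C proj₁ (to y))
      edge (x , x∈) (y , y∈) with i , refl ← ∈-image⁻ after x∈ | j , refl ← ∈-image⁻ after y∈ =
        mk⇔ (edges⇒~C i j) (~C⇒edges i j)

  -- Difference families from zero-sum simple orderings.

  cycleOfSize : ∀ {ℓ} .{{_ : NonZero ℓ}} (ω : List (ℤ/ v)) → length ω ≡ ℓ → sum ω ≡ 0# → SimpleOrdering ω →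
    Unique (± ω) → 0# ∉ ± ω → ∃ λ Γ → (Γ ≅ C ℓ) × (Δ Γ ↭ ± ω)
  -- Matching on `refl` sets `ℓ` to `length ω`; with `ℓ` abstract, all blocks of a family are
  -- compared with one graph `C ℓ`.
  cycleOfSize ω refl sum≡0 simple unique 0∉± = cycle , cycle-≅ , cycle-Δ
    where open Cycle ω sum≡0 simple unique 0∉±

  -- The permutation hypothesis does double duty: it makes the signed entries of each block distinct
  -- and nonzero, as the cycle construction requires, and it gives the multiplicities in the whole
  -- family.
  blocks⇒differenceFamily : ∀ {t ℓ p} .{{_ : NonZero ℓ}} {J : Subset v} → t ∣ v → IsSubgroupOfOrder t J →
    (ω : Fin p → List (ℤ/ v)) → (∀ i → length (ω i) ≡ ℓ) → (∀ i → sum (ω i) ≡ 0#) → (∀ i → SimpleOrdering (ω i)) →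
    concatMap (±_ ∘ ω) (allFin p) ↭ elements (∁ J) → ∃ λ F → IsDifferenceFamily v t (C ℓ) 1 F
  blocks⇒differenceFamily {t} {ℓ} {p} {J} t∣v J-subgroup ω size sum≡0 simple ±↭ =
    map (proj₁ ∘ block) (allFin p) , record
      { t∣v        = t∣v
      ; J          = J
      ; J-subgroup = J-subgroup
      ; blocks     = Allₚ.map⁺ (All.universal (proj₁ ∘ proj₂ ∘ block) (allFin p))
      ; outside-J  = λ x x∉J → ≡-trans (multiplicity-↭ x Δs↭)
                                       (multiplicity-unique (elements-unique (∁ J)) (∈-elements⁺ (x∉p⇒x∈∁p x∉J)))
      ; inside-J   = λ x x∈J x∈Δs → x∈p⇒x∉∁p x∈J (∈-elements⁻ (∈-resp-↭ Δs↭ x∈Δs))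
      }
    where
    unique : ∀ i → Unique (± ω i)
    unique i = Unique-concatMap⁻ (±_ ∘ ω) (Unique-resp-↭ (↭-sym ±↭) (elements-unique (∁ J))) (∈-allFin i)

    -- 0 lies in `J`, whereas every signed entry lies outside.
    0∉± : ∀ i → 0# ∉ ± ω i
    0∉± i 0∈ = x∈p⇒x∉∁p (IsSubgroupOfOrder.0∈J J-subgroup)
      (∈-elements⁻ (∈-resp-↭ ±↭ (∈-concatMap⁺ (±_ ∘ ω) (Any.map (λ { refl → 0∈ }) (∈-allFin i)))))

    block : ∀ i → ∃ λ Γ → (Γ ≅ C ℓ) × (Δ Γ ↭ ± ω i)
    block i = cycleOfSize (ω i) (size i) (sum≡0 i) (simple i) (unique i) (0∉± i)

    Δs↭ : Δs (map (proj₁ ∘ block) (allFin p)) ↭ elements (∁ J)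
    Δs↭ = begin
      Δs (map (proj₁ ∘ block) (allFin p))       ≡⟨ concatMap-map Δ (proj₁ ∘ block) (allFin p) ⟩
      concatMap (Δ ∘ proj₁ ∘ block) (allFin p)  ↭⟨ concatMap-cong-↭ (proj₂ ∘ proj₂ ∘ block) (allFin p) ⟩
      concatMap (±_ ∘ ω) (allFin p)             ↭⟨ ±↭ ⟩
      elements (∁ J)                            ∎
      where open PermutationReasoning

  -- Replacing each line by its simple ordering preserves its length, its sum and, up to
  -- permutation, its signed entries.
  lines⇒differenceFamily : ∀ {t ℓ p} .{{_ : NonZero ℓ}} {J : Subset v} → t ∣ v → IsSubgroupOfOrder t J →
    (line : Fin p → List (ℤ/ v)) → (∀ i → length (line i) ≡ ℓ) → (∀ i → sum (line i) ≡ 0#) →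
    (∀ i → ∃ λ ω → (ω ↭ line i) × SimpleOrdering ω) →
    ± concatMap line (allFin p) ↭ elements (∁ J) → ∃ λ F → IsDifferenceFamily v t (C ℓ) 1 F
  lines⇒differenceFamily {p = p} {J = J} t∣v J-subgroup line size sum≡0 orderings ±↭ =
    blocks⇒differenceFamily t∣v J-subgroup (proj₁ ∘ orderings)
      (λ i → ≡-trans (↭-length (ω↭line i)) (size i))
      (λ i → ≡-trans (sum-↭ (ω↭line i)) (sum≡0 i))
      (λ i → proj₂ (proj₂ (orderings i)))
      (begin
        concatMap (±_ ∘ proj₁ ∘ orderings) (allFin p) ↭⟨ concatMap-cong-↭ (λ i → concatMap⁺-↭ _ (ω↭line i)) (allFin p) ⟩
        concatMap (±_ ∘ line) (allFin p)              ≡⟨ concatMap-concatMap _ line (allFin p) ⟨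
        ± concatMap line (allFin p)                   ↭⟨ ±↭ ⟩
        elements (∁ J)                                ∎)
    where
    open PermutationReasoning
    ω↭line = λ i → proj₁ (proj₂ (orderings i))

-- The entries of an array, by rows and by columns.

module _ {m n : ℕ} (M : PFArray A m n) where

  row≡cells : ∀ i → row M i ≡ concatMap (λ j → fromMaybe (M i j)) (allFin n)
  row≡cells i = ≡-trans (cong catMaybes (sym (map-tabulate id (M i)))) (catMaybes-map (M i) (allFin n))

  column≡cells : ∀ j → column M j ≡ concatMap (λ i → fromMaybe (M i j)) (allFin m)
  column≡cells j = ≡-trans (cong catMaybes (sym (map-tabulate id (flip M j)))) (catMaybes-map (flip M j) (allFin m))

  rows↭columns : concatMap (row M) (allFin m) ↭ concatMap (column M) (allFin n)
  rows↭columns = begin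
    concatMap (row M) (allFin m)
      ≡⟨ concatMap-cong row≡cells (allFin m) ⟩
    concatMap (λ i → concatMap (λ j → fromMaybe (M i j)) (allFin n)) (allFin m)
      ↭⟨ concatMap-comm (λ i j → fromMaybe (M i j)) (allFin m) (allFin n) ⟩
    concatMap (λ j → concatMap (λ i → fromMaybe (M i j)) (allFin m)) (allFin n)
      ≡⟨ concatMap-cong column≡cells (allFin n) ⟨
    concatMap (column M) (allFin n)
      ∎
    where open PermutationReasoning

  appears⇒∈columns : ∀ {x} → Appears M x → x ∈ concatMap (column M) (allFin n)
  appears⇒∈columns {x} (i , j , Mij≡x) =
    ∈-concatMap⁺ (column M) (Any.map (λ { refl → x∈column }) (∈-allFin j))
    where
    x∈column : x ∈ column M j
    x∈column = subst (x ∈_) (sym (column≡cells j))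
      (∈-concatMap⁺ _ (Any.map (λ { refl → subst (λ c → x ∈ fromMaybe c) (sym Mij≡x) (here refl) }) (∈-allFin i)))

-- From Heffter arrays to difference families.

differenceFamily-cong : ∀ {v w t N μ} .{{_ : NonZero v}} .{{_ : NonZero w}} {Γ : Graph N} → v ≡ w →
  (∃ λ F → IsDifferenceFamily v t Γ μ F) → (∃ λ F → IsDifferenceFamily w t Γ μ F)
-- The two `NonZero` proofs are irrelevant, so identifying the orders suffices.
differenceFamily-cong refl F = F

proposition2p5 : (m n s k t : ℕ) .{{_ : NonZero m}} .{{_ : NonZero n}} .{{_ : NonZero s}} .{{_ : NonZero k}} .{{_ : NonZero t}} →
    (∃ λ A → IsHeffterArray m n s k t {{+-nonZeroʳ (2 * n * k) t}} A × SimpleArray {{+-nonZeroʳ (2 * n * k) t}} A) →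
    (∃ λ F → IsDifferenceFamily (2 * m * s + t) t {{+-nonZeroʳ (2 * m * s) t}} (C s) 1 F) ×
    (∃ λ F → IsDifferenceFamily (2 * n * k + t) t {{+-nonZeroʳ (2 * n * k) t}} (C k) 1 F)
proposition2p5 m n s k t (M , heffter , simple-rows , simple-columns) =
  -- The rows give a family over the order `2 * n * k + t` of the array, which is then carried to
  -- the equal order `2 * m * s + t`. Since rows and columns list the same entries, `complement↭`
  -- serves both families.
  differenceFamily-cong same-order
    (lines⇒differenceFamily t∣v J-subgroup (row M) row-size row-sum simple-rows
      (↭-trans (concatMap⁺-↭ _ (rows↭columns M)) (↭-sym complement↭))) ,
  lines⇒differenceFamily t∣v J-subgroup (column M) column-size column-sum simple-columns (↭-sym complement↭)
  where
  instance
    order-nonZero : NonZero (2 * n * k + t)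
    order-nonZero = +-nonZeroʳ (2 * n * k) t
    order-nonZero′ : NonZero (2 * m * s + t)
    order-nonZero′ = +-nonZeroʳ (2 * m * s) t

  open IsHeffterArray heffter

  entries : List (ℤ/ (2 * n * k + t))
  entries = concatMap (column M) (allFin n)

  t∣v : t ∣ 2 * n * k + t
  t∣v = ∣m∣n⇒∣m+n t∣2nk ∣-refl

  length-lines : ∀ {p ℓ} (line : Fin p → List (ℤ/ (2 * n * k + t))) → (∀ i → length (line i) ≡ ℓ) →
                 length (concatMap line (allFin p)) ≡ p * ℓ
  length-lines {p} {ℓ} line size =
    ≡-trans (length-concatMap line size (allFin p)) (cong (_* ℓ) (length-tabulate {n = p} (λ i → i)))

  -- Double counting of the filled cells.
  nk≡ms : n * k ≡ m * s
  nk≡ms = begin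
    n * k                                 ≡⟨ length-lines (column M) column-size ⟨
    length entries                        ≡⟨ ↭-length (rows↭columns M) ⟨
    length (concatMap (row M) (allFin m)) ≡⟨ length-lines (row M) row-size ⟩
    m * s                                 ∎
    where open ≡-Reasoning

  same-order : 2 * n * k + t ≡ 2 * m * s + t
  same-order = cong (_+ t) (≡-trans (*-assoc 2 n k) (≡-trans (cong (2 *_) nk≡ms) (sym (*-assoc 2 m s))))

  -- The `n * k` entries have `2 * n * k` signed versions, and removing the `t` elements of `J` from
  -- the group leaves as many elements.
  length-entries : length (± entries) ≡ length (elements (∁ J))
  length-entries = begin
    length (± entries)         ≡⟨ length-± entries ⟩
    2 * length entries         ≡⟨ cong (2 *_) (length-lines (column M) column-size) ⟩
    2 * (n * k)                ≡⟨ *-assoc 2 n k ⟨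
    2 * n * k                  ≡⟨ m+n∸n≡m (2 * n * k) t ⟨
    2 * n * k + t ∸ t          ≡⟨ cong (2 * n * k + t ∸_) (IsSubgroupOfOrder.order J-subgroup) ⟨
    2 * n * k + t ∸ ∣ J ∣      ≡⟨ ∣∁p∣≡n∸∣p∣ J ⟨
    ∣ ∁ J ∣                    ≡⟨ length-elements (∁ J) ⟨
    length (elements (∁ J))    ∎
    where open ≡-Reasoning

  complement⊆± : elements (∁ J) ⊆ ± entries
  complement⊆± {x} x∈ with covers x (x∈∁p⇒x∉p (∈-elements⁻ x∈))
  ... | inj₁ x-appears  = ∈-±⁺ (inj₁ (appears⇒∈columns M x-appears))
  ... | inj₂ -x-appears = ∈-±⁺ (inj₂ (appears⇒∈columns M -x-appears))

  -- The covering condition gives only an inclusion; equal lengths leave no room for a repeated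
  -- signed entry or for one in `J`.
  complement↭ : elements (∁ J) ↭ ± entries
  complement↭ = unique∧⊆∧length⇒↭ (elements-unique (∁ J)) complement⊆± (≤-reflexive length-entries)
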